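{- Let $\ell$ be an odd prime. Then, as $T\to\infty$, $$|S^1(\ell,T)| \ll T,$$ where the implied constant may depend on $\ell$.
   Context: $\Phi_\ell(X)$ denotes the $\ell$-th cyclotomic polynomial. For a natural number $n$, $R_\ell(n):=\min\{d\in\mathbb{N}: n\mid \Phi_\ell(d)\}$ if such $d$ exists, and $R_\ell(n)=\infty$ otherwise. $\mathbb{P}$ denotes the set of primes $p$ that divide $\Phi_\ell(d)$ for some $d\in\mathbb{N}$. For a positive integer $i$ and real $T$, $S^i(\ell,T):=\{p\in\mathbb{P}: R_\ell(p^i)\le T\}$. -}

module Defs where

open import Data.Nat as ℕ using (ℕ; zero; suc)
import Data.Nat.Properties as ℕ
open import Data.Nat.Divisibility using (_∣?_)
open import Data.Nat.Primality using (Prime)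
open import Data.Integer as ℤ using (ℤ; +_; 0ℤ; 1ℤ; -1ℤ)
import Data.Integer.Divisibility as ℤ
open import Data.Rational as ℚ using (ℚ; 0ℚ; 1ℚ; 1/_; ∣_∣)
import Data.Rational.Properties as ℚ
open import Data.Rational.Solver using (module +-*-Solver)
open import Data.Fin using (Fin)
open import Data.List using (List; []; _∷_; _++_; map; foldl; filter; length; replicate; applyUpTo)
open import Data.Product using (Σ; ∃-syntax; _×_; _,_; proj₁; proj₂)
open import Data.Empty using (⊥)
open import Function.Bundles using (Injection)
open import Relation.Binary.PropositionalEquality using (_≡_; refl; cong; setoid; module ≡-Reasoning)
import Relation.Binary.Construct.On as On
open import Relation.Nullary using (¬_)
open import Relation.Nullary.Construct.Add.Supremum using (_⁺; ⊤⁺; [_])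

------------------------------------------------------------------------
-- Real numbers are Cauchy sequences of rationals; two of them represent the
-- same number when each is ≤ the other.

record ℝ : Set where
  constructor mkℝ
  field
    seq    : ℕ → ℚ
    cauchy : ∀ ε → 0ℚ ℚ.< ε →
             ∃[ N ] ∀ m n → N ℕ.≤ m → N ℕ.≤ n → ∣ seq m ℚ.- seq n ∣ ℚ.< ε

open ℝ public

infix 4 _≤_
infixl 7 _*_

_≤_ : ℝ → ℝ → Set
x ≤ y = ∀ ε → 0ℚ ℚ.< ε → ∃[ N ] ∀ n → N ℕ.≤ n → seq x n ℚ.≤ seq y n ℚ.+ ε

fromℚ : ℚ → ℝ
fromℚ q = mkℝ (λ _ → q) λ ε 0<ε → 0 , λ _ _ _ _ → begin-strict
    ∣ q ℚ.- q ∣ ≡⟨ cong ∣_∣ (ℚ.+-inverseʳ q) ⟩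
    0ℚ          <⟨ 0<ε ⟩
    ε           ∎
  where open ℚ.≤-Reasoning

fromℕ : ℕ → ℝ
fromℕ n = fromℚ (+ n ℚ./ 1)

private
  sub-add : ∀ b a → b ≡ (b ℚ.- a) ℚ.+ a
  sub-add = solve 2 (λ b a → b := (b :- a) :+ a) refl
    where open +-*-Solver

  mul-sub-mul : ∀ a b c d →
    a ℚ.* b ℚ.- c ℚ.* d ≡ a ℚ.* (b ℚ.- d) ℚ.+ d ℚ.* (a ℚ.- c)
  mul-sub-mul = solve 4 (λ a b c d → a :* b :- c :* d := a :* (b :- d) :+ d :* (a :- c)) refl
    where open +-*-Solver

  eventuallyBounded : (x : ℝ) →
    Σ ℚ λ B → 0ℚ ℚ.< B × ∃[ N ] ∀ n → N ℕ.≤ n → ∣ seq x n ∣ ℚ.≤ B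
  eventuallyBounded x with cauchy x 1ℚ (ℚ.positive⁻¹ 1ℚ)
  ... | N , close = 1ℚ ℚ.+ ∣ a ∣ , 0<B , N , bound
    where
    open ℚ.≤-Reasoning
    a = seq x N

    0<B : 0ℚ ℚ.< 1ℚ ℚ.+ ∣ a ∣
    0<B = ℚ.+-mono-<-≤ (ℚ.positive⁻¹ 1ℚ) (ℚ.0≤∣p∣ a)

    bound : ∀ n → N ℕ.≤ n → ∣ seq x n ∣ ℚ.≤ 1ℚ ℚ.+ ∣ a ∣
    bound n N≤n = begin
      ∣ b ∣                   ≡⟨ cong ∣_∣ (sub-add b a) ⟩
      ∣ (b ℚ.- a) ℚ.+ a ∣     ≤⟨ ℚ.∣p+q∣≤∣p∣+∣q∣ (b ℚ.- a) a ⟩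
      ∣ b ℚ.- a ∣ ℚ.+ ∣ a ∣   ≤⟨ ℚ.+-monoˡ-≤ ∣ a ∣ (ℚ.<⇒≤ (close n N N≤n ℕ.≤-refl)) ⟩
      1ℚ ℚ.+ ∣ a ∣            ∎
      where b = seq x n

  divideBy : ∀ M ε → 0ℚ ℚ.< M → 0ℚ ℚ.< ε → Σ ℚ λ δ → 0ℚ ℚ.< δ × M ℚ.* δ ≡ ε
  divideBy M ε 0<M 0<ε = r ℚ.* ε , ℚ.positive⁻¹ (r ℚ.* ε) ⦃ r*ε⁺ ⦄ , (begin
      M ℚ.* (r ℚ.* ε) ≡⟨ ℚ.*-assoc M r ε ⟨
      M ℚ.* r ℚ.* ε   ≡⟨ cong (ℚ._* ε) (ℚ.*-inverseʳ M ⦃ M≢0 ⦄) ⟩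
      1ℚ ℚ.* ε        ≡⟨ ℚ.*-identityˡ ε ⟩
      ε               ∎)
    where
    open ≡-Reasoning
    M≢0 : ℚ.NonZero M
    M≢0 = ℚ.pos⇒nonZero M ⦃ ℚ.positive 0<M ⦄
    r : ℚ
    r = (1/ M) ⦃ M≢0 ⦄
    r*ε⁺ : ℚ.Positive (r ℚ.* ε)
    r*ε⁺ = ℚ.pos*pos⇒pos r ⦃ ℚ.1/pos⇒pos M ⦃ ℚ.positive 0<M ⦄ ⦄ ε ⦃ ℚ.positive 0<ε ⦄

  mul-small : ∀ M δ p q → 0ℚ ℚ.< M → ∣ p ∣ ℚ.≤ M → ∣ q ∣ ℚ.< δ → ∣ p ℚ.* q ∣ ℚ.< M ℚ.* δ
  mul-small M δ p q 0<M p≤M q<δ = begin-strict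
      ∣ p ℚ.* q ∣       ≡⟨ ℚ.∣p*q∣≡∣p∣*∣q∣ p q ⟩
      ∣ p ∣ ℚ.* ∣ q ∣   ≤⟨ ℚ.*-monoʳ-≤-nonNeg ∣ q ∣ ⦃ ℚ.∣-∣-nonNeg q ⦄ p≤M ⟩
      M ℚ.* ∣ q ∣       <⟨ ℚ.*-monoʳ-<-pos M ⦃ ℚ.positive 0<M ⦄ q<δ ⟩
      M ℚ.* δ           ∎
    where open ℚ.≤-Reasoning

  mul-close : ∀ A B δ ε → (A ℚ.+ B) ℚ.* δ ≡ ε → ∀ a b c d → 0ℚ ℚ.< A → 0ℚ ℚ.< B →
    ∣ a ∣ ℚ.≤ A → ∣ d ∣ ℚ.≤ B → ∣ a ℚ.- c ∣ ℚ.< δ → ∣ b ℚ.- d ∣ ℚ.< δ →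
    ∣ a ℚ.* b ℚ.- c ℚ.* d ∣ ℚ.< ε
  mul-close A B δ ε [A+B]δ≡ε a b c d 0<A 0<B a≤A d≤B ac<δ bd<δ = begin-strict
      ∣ a ℚ.* b ℚ.- c ℚ.* d ∣
        ≡⟨ cong ∣_∣ (mul-sub-mul a b c d) ⟩
      ∣ a ℚ.* (b ℚ.- d) ℚ.+ d ℚ.* (a ℚ.- c) ∣
        ≤⟨ ℚ.∣p+q∣≤∣p∣+∣q∣ (a ℚ.* (b ℚ.- d)) (d ℚ.* (a ℚ.- c)) ⟩
      ∣ a ℚ.* (b ℚ.- d) ∣ ℚ.+ ∣ d ℚ.* (a ℚ.- c) ∣
        <⟨ ℚ.+-mono-< (mul-small A δ a (b ℚ.- d) 0<A a≤A bd<δ)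
                      (mul-small B δ d (a ℚ.- c) 0<B d≤B ac<δ) ⟩
      A ℚ.* δ ℚ.+ B ℚ.* δ
        ≡⟨ ℚ.*-distribʳ-+ δ A B ⟨
      (A ℚ.+ B) ℚ.* δ
        ≡⟨ [A+B]δ≡ε ⟩
      ε ∎
    where open ℚ.≤-Reasoning

  add-pos : ∀ p q → 0ℚ ℚ.< p → 0ℚ ℚ.< q → 0ℚ ℚ.< p ℚ.+ q
  add-pos p q 0<p 0<q = ℚ.positive⁻¹ (p ℚ.+ q)
    ⦃ ℚ.pos+pos⇒pos p ⦃ ℚ.positive 0<p ⦄ q ⦃ ℚ.positive 0<q ⦄ ⦄

  mul-cauchy : (x y : ℝ) → ∀ ε → 0ℚ ℚ.< ε →
    ∃[ N ] ∀ m n → N ℕ.≤ m → N ℕ.≤ n →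
    ∣ seq x m ℚ.* seq y m ℚ.- seq x n ℚ.* seq y n ∣ ℚ.< ε
  mul-cauchy x y ε 0<ε =
    let A , 0<A , K , x≤A = eventuallyBounded x
        B , 0<B , L , y≤B = eventuallyBounded y
        δ , 0<δ , [A+B]δ≡ε = divideBy (A ℚ.+ B) ε (add-pos A B 0<A 0<B) 0<ε
        P , x-close = cauchy x δ 0<δ
        Q , y-close = cauchy y δ 0<δ
    in (K ℕ.⊔ L) ℕ.⊔ (P ℕ.⊔ Q) , λ m n N≤m N≤n →
    let KL≤m = ℕ.m⊔n≤o⇒m≤o (K ℕ.⊔ L) (P ℕ.⊔ Q) N≤m
        PQ≤m = ℕ.m⊔n≤o⇒n≤o (K ℕ.⊔ L) (P ℕ.⊔ Q) N≤m
        KL≤n = ℕ.m⊔n≤o⇒m≤o (K ℕ.⊔ L) (P ℕ.⊔ Q) N≤n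
        PQ≤n = ℕ.m⊔n≤o⇒n≤o (K ℕ.⊔ L) (P ℕ.⊔ Q) N≤n
    in mul-close A B δ ε [A+B]δ≡ε (seq x m) (seq y m) (seq x n) (seq y n) 0<A 0<B
         (x≤A m (ℕ.m⊔n≤o⇒m≤o K L KL≤m))
         (y≤B n (ℕ.m⊔n≤o⇒n≤o K L KL≤n))
         (x-close m n (ℕ.m⊔n≤o⇒m≤o P Q PQ≤m) (ℕ.m⊔n≤o⇒m≤o P Q PQ≤n))
         (y-close m n (ℕ.m⊔n≤o⇒n≤o P Q PQ≤m) (ℕ.m⊔n≤o⇒n≤o P Q PQ≤n))

_*_ : ℝ → ℝ → ℝ
x * y = mkℝ (λ n → seq x n ℚ.* seq y n) (mul-cauchy x y)

------------------------------------------------------------------------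
-- Integer polynomials, as coefficient lists with the leading coefficient
-- first.

Poly : Set
Poly = List ℤ

eval : Poly → ℤ → ℤ
eval p x = foldl (λ acc c → acc ℤ.* x ℤ.+ c) 0ℤ p

infixl 6 _∸ᵖ_
infixl 7 _÷_

-- Subtraction aligned at the leading coefficients.
_∸ᵖ_ : Poly → Poly → Poly
[]       ∸ᵖ _        = []
(a ∷ as) ∸ᵖ []       = a ∷ as
(a ∷ as) ∸ᵖ (b ∷ bs) = (a ℤ.- b) ∷ (as ∸ᵖ bs)

-- Long division by the monic polynomial with coefficients 1 ∷ q,
-- stopping after k coefficients of the quotient.
longDivision : ℕ → Poly → Poly → Poly
longDivision zero    _        _ = []
longDivision (suc _) []       _ = []
longDivision (suc k) (a ∷ as) q = a ∷ longDivision k (as ∸ᵖ map (a ℤ.*_) q) q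

-- The quotient of p by q, for q monic.
_÷_ : Poly → Poly → Poly
p ÷ []      = []
p ÷ (_ ∷ q) = longDivision (length p ℕ.∸ length q) p q

-- X ^ suc m - 1
powerMinusOne : ℕ → Poly
powerMinusOne m = 1ℤ ∷ replicate m 0ℤ ++ -1ℤ ∷ []

properDivisors : ℕ → List ℕ
properDivisors n = filter (_∣? n) (applyUpTo suc (ℕ.pred n))

-- The cyclotomic polynomials, determined by ∏_{d ∣ n} Φ d = X^n - 1, i.e.
-- Φ n is X^n - 1 divided successively by Φ d for the proper divisors d of n.
-- The first argument of Φ′ bounds the depth of the recursion; since proper
-- divisors of n are smaller than n, the bound n suffices.
Φ′ : ℕ → ℕ → Poly
Φ′ zero    _       = 1ℤ ∷ []
Φ′ (suc _) zero    = 1ℤ ∷ []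
Φ′ (suc k) (suc m) = foldl _÷_ (powerMinusOne m) (map (Φ′ k) (properDivisors (suc m)))

Φ : ℕ → Poly
Φ n = Φ′ n n

_ : Φ 1 ≡ 1ℤ ∷ -1ℤ ∷ []
_ = refl

_ : Φ 5 ≡ 1ℤ ∷ 1ℤ ∷ 1ℤ ∷ 1ℤ ∷ 1ℤ ∷ []
_ = refl

_ : Φ 12 ≡ 1ℤ ∷ 0ℤ ∷ -1ℤ ∷ 0ℤ ∷ 1ℤ ∷ []
_ = refl

------------------------------------------------------------------------

infix 4 _∣Φ[_]_ _≤⁺_

_∣Φ[_]_ : ℕ → ℕ → ℕ → Set
n ∣Φ[ ℓ ] d = + n ℤ.∣ eval (Φ ℓ) (+ d)

-- IsR ℓ n r says that R_ℓ(n) = r, where ⊤⁺ plays the role of ∞.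
IsR : ℕ → ℕ → ℕ ⁺ → Set
IsR ℓ n [ d ] = n ∣Φ[ ℓ ] d × (∀ e → n ∣Φ[ ℓ ] e → d ℕ.≤ e)
IsR ℓ n ⊤⁺    = ∀ d → ¬ n ∣Φ[ ℓ ] d

_≤⁺_ : ℕ ⁺ → ℝ → Set
[ d ] ≤⁺ T = fromℕ d ≤ T
⊤⁺    ≤⁺ T = ⊥

ℙ : ℕ → ℕ → Set
ℙ ℓ p = Prime p × ∃[ d ] p ∣Φ[ ℓ ] d

S : ℕ → ℕ → ℝ → ℕ → Set
S i ℓ T p = ℙ ℓ p × ∃[ r ] IsR ℓ (p ℕ.^ i) r × r ≤⁺ T

-- The cardinality of A is at most x: A injects into a finite set with at most
-- x elements.  Elements of A are compared as numbers, ignoring the membership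
-- proofs.
∣_∣≤_ : (ℕ → Set) → ℝ → Set
∣ A ∣≤ x = ∃[ n ] Injection (On.setoid (setoid ℕ) (proj₁ {B = A})) (setoid (Fin n)) × fromℕ n ≤ x

{-# OPTIONS --safe #-}

-- If R_ℓ(p) ≤ T, then p divides Φ_ℓ(d) for some d ≤ T.  There are O(T) such
-- primes p ≤ T.  For each d ≤ T at most ℓ primes p > T (counted with
-- multiplicity) divide Φ_ℓ(d), since
-- 0 < Φ_ℓ(d) = 1 + d + ⋯ + d^(ℓ-1) ≤ (1 + d)^ℓ, so these contribute O(ℓ T).
module Submission where

open import Defs
open import Data.Nat using (ℕ)
open import Data.Nat.Divisibility using (_∤_)
open import Data.Nat.Primality using (Prime)
open import Data.Product using (∃-syntax)

open import Data.Fin using (Fin)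
open import Data.Integer as ℤ using (+_; 0ℤ; 1ℤ; -1ℤ)
import Data.Integer.Properties as ℤ
open import Data.List using (List; []; _∷_; _++_; concatMap; filter; foldl; length; map; replicate; upTo)
open import Data.List.Membership.DecPropositional using (_∈?_)
open import Data.List.Membership.Propositional using (_∈_; lose)
open import Data.List.Membership.Propositional.Properties
  using (∈-++⁺ˡ; ∈-++⁺ʳ; ∈-concatMap⁺; ∈-filter⁺; ∈-upTo⁺)
open import Data.List.Membership.Setoid.Properties using (index-injective)
open import Data.List.Properties using (filter-accept; filter-none; filter-reject; length-++; length-upTo)
open import Data.List.Relation.Unary.All as All using (All; []; _∷_)
open import Data.List.Relation.Unary.All.Properties using (all-upTo; applyUpTo⁺₁)
open import Data.List.Relation.Unary.Any using (index)
open import Data.Nat as ℕ using (zero; suc; NonZero; z≤n; s≤s)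
open import Data.Nat.Coprimality as Coprimality using (1-coprimeTo)
open import Data.Nat.Divisibility using (_∣_; _∣?_; 1∣_; ∣-reflexive; ∣-trans)
open import Data.Nat.ListAction using (product)
open import Data.Nat.Primality using (prime⇒irreducible; prime⇒nonZero)
open import Data.Nat.Primality.Factorisation
  using (PrimeFactorisation; factorise; factorisationHasAllPrimeFactors)
import Data.Nat.Properties as ℕ
open import Data.Product using (_×_; _,_; proj₁; proj₂)
open import Data.Rational as ℚ using (ℚ; mkℚ; 0ℚ; 1ℚ; ∣_∣)
import Data.Rational.Properties as ℚ
open import Data.Rational.Solver using (module +-*-Solver)
open import Data.Sum using (inj₁; inj₂)
open import Function using (_∘_)
open import Function.Bundles using (Injection)
open import Relation.Binary.PropositionalEquality
  using (_≡_; refl; sym; trans; cong; cong₂; subst; setoid)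
import Relation.Binary.Construct.On as On
open import Relation.Nullary using (yes; no; contradiction)
open import Relation.Nullary.Construct.Add.Supremum using ([_])
open import Relation.Nullary.Decidable using (recompute)

open PrimeFactorisation using (factors; isFactorisation; factorsPrime)

-- Coefficients of the cyclotomic polynomial of prime index.

∸ᵖ-identityʳ : ∀ p → p ∸ᵖ [] ≡ p
∸ᵖ-identityʳ []      = refl
∸ᵖ-identityʳ (_ ∷ _) = refl

-- Subtracting -1 from the next coefficient 0 leaves 1, so after each step the dividend has the same
-- shape, one degree lower.
longDivision-X-1 : ∀ n → let p = replicate n 0ℤ ++ -1ℤ ∷ [] in
  longDivision (length p) (1ℤ ∷ p) (-1ℤ ∷ []) ≡ replicate (suc n) 1ℤ
longDivision-X-1 zero    = refl
longDivision-X-1 (suc n)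
  rewrite ∸ᵖ-identityʳ (replicate n 0ℤ ++ -1ℤ ∷ []) = cong (1ℤ ∷_) (longDivision-X-1 n)

properDivisors-prime : ∀ {ℓ} → Prime ℓ → properDivisors ℓ ≡ 1 ∷ []
properDivisors-prime {suc (suc m)} ℓ-prime = trans
  (filter-accept (_∣? suc (suc m)) (1∣ suc (suc m)))
  (cong (1 ∷_) (filter-none (_∣? suc (suc m)) (applyUpTo⁺₁ (suc ∘ suc) m 2+i∤ℓ)))
  where
  2+i∤ℓ : ∀ {i} → i ℕ.< m → suc (suc i) ∤ suc (suc m)
  2+i∤ℓ i<m 2+i∣ℓ with prime⇒irreducible ℓ-prime 2+i∣ℓ
  ... | inj₂ refl = ℕ.<-irrefl refl i<m

-- The only division performed is by `Φ′ (suc m) 1`, which computes to X - 1.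
Φ-prime : ∀ {ℓ} → Prime ℓ → Φ ℓ ≡ replicate ℓ 1ℤ
Φ-prime {suc (suc m)} ℓ-prime = trans
  (cong (λ ds → foldl _÷_ (powerMinusOne (suc m)) (map (Φ′ (suc m)) ds)) (properDivisors-prime ℓ-prime))
  (longDivision-X-1 (suc m))

-- Positivity and size of the values at natural numbers.

-- a dⁿ + dⁿ⁻¹ + ⋯ + d + 1, by Horner's rule.
horner : ℕ → ℕ → ℕ → ℕ
horner d a zero    = a
horner d a (suc n) = horner d (a ℕ.* d ℕ.+ 1) n

foldl-replicate-1 : ∀ d a n →
  foldl (λ acc c → acc ℤ.* + d ℤ.+ c) (+ a) (replicate n 1ℤ) ≡ + horner d a n
foldl-replicate-1 d a zero    = refl
foldl-replicate-1 d a (suc n)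
  rewrite sym (ℤ.pos-* a d) = foldl-replicate-1 d (a ℕ.* d ℕ.+ 1) n

-- Each Horner step sends a to a d + 1, while the majorant b is multiplied by d + 1; a ≤ b and 1 ≤ b
-- survive the step. The case needed is a = 0, b = 1.
horner-≤ : ∀ d {a b} n → a ℕ.≤ b → 1 ℕ.≤ b → horner d a n ℕ.≤ b ℕ.* suc d ℕ.^ n
horner-≤ d {a} {b} zero    a≤b _   = ℕ.≤-trans a≤b (ℕ.≤-reflexive (sym (ℕ.*-identityʳ b)))
horner-≤ d {a} {b} (suc n) a≤b 1≤b = begin
  horner d (a ℕ.* d ℕ.+ 1) n       ≤⟨ horner-≤ d n ad+1≤b[1+d] 1≤b[1+d] ⟩
  b ℕ.* suc d ℕ.* suc d ℕ.^ n      ≡⟨ ℕ.*-assoc b (suc d) (suc d ℕ.^ n) ⟩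
  b ℕ.* (suc d ℕ.* suc d ℕ.^ n)    ∎
  where
  open ℕ.≤-Reasoning
  1≤b[1+d] : 1 ℕ.≤ b ℕ.* suc d
  1≤b[1+d] = ℕ.*-mono-≤ 1≤b (s≤s z≤n)
  ad+1≤b[1+d] : a ℕ.* d ℕ.+ 1 ℕ.≤ b ℕ.* suc d
  ad+1≤b[1+d] = begin
    a ℕ.* d ℕ.+ 1  ≤⟨ ℕ.+-mono-≤ (ℕ.*-monoˡ-≤ d a≤b) 1≤b ⟩
    b ℕ.* d ℕ.+ b  ≡⟨ ℕ.+-comm (b ℕ.* d) b ⟩
    b ℕ.+ b ℕ.* d  ≡⟨ ℕ.*-suc b d ⟨
    b ℕ.* suc d    ∎

horner-nonZero : ∀ d {a} n → 1 ℕ.≤ a → NonZero (horner d a n)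
horner-nonZero d     zero    1≤a = ℕ.>-nonZero 1≤a
horner-nonZero d {a} (suc n) 1≤a = horner-nonZero d n (ℕ.m≤n+m 1 (a ℕ.* d))

Φ-prime-value : ∀ {ℓ} → Prime ℓ → ∀ d → ℤ.∣ eval (Φ ℓ) (+ d) ∣ ≡ horner d 0 ℓ
Φ-prime-value {ℓ} ℓ-prime d rewrite Φ-prime ℓ-prime = cong ℤ.∣_∣ (foldl-replicate-1 d 0 ℓ)

Φ-prime-nonZero : ∀ {ℓ} → Prime ℓ → ∀ d → NonZero ℤ.∣ eval (Φ ℓ) (+ d) ∣
Φ-prime-nonZero {suc m} ℓ-prime d =
  -- The first Horner step turns the accumulator 0 into 1, so the value is positive even at d = 0.
  subst NonZero (sym (Φ-prime-value ℓ-prime d)) (horner-nonZero d m (s≤s z≤n))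

Φ-prime-≤ : ∀ {ℓ} → Prime ℓ → ∀ d → ℤ.∣ eval (Φ ℓ) (+ d) ∣ ℕ.≤ suc d ℕ.^ ℓ
Φ-prime-≤ {ℓ} ℓ-prime d = begin
  ℤ.∣ eval (Φ ℓ) (+ d) ∣  ≡⟨ Φ-prime-value ℓ-prime d ⟩
  horner d 0 ℓ            ≤⟨ horner-≤ d ℓ z≤n ℕ.≤-refl ⟩
  1 ℕ.* suc d ℕ.^ ℓ       ≡⟨ ℕ.*-identityˡ (suc d ℕ.^ ℓ) ⟩
  suc d ℕ.^ ℓ             ∎
  where open ℕ.≤-Reasoning

-- Counting large prime factors.

-- Entries above t contribute a factor of at least t + 1, the others a factor of at least 1.
^length-filter≤product : ∀ t {ns} → All NonZero ns → suc t ℕ.^ length (filter (t ℕ.<?_) ns) ℕ.≤ product ns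
^length-filter≤product t []                = ℕ.≤-refl
^length-filter≤product t {n ∷ ns} (n≢0 ∷ ns≢0) with t ℕ.<? n
... | yes t<n rewrite filter-accept (t ℕ.<?_) {xs = ns} t<n =
  ℕ.*-mono-≤ t<n (^length-filter≤product t ns≢0)
... | no  t≮n rewrite filter-reject (t ℕ.<?_) {xs = ns} t≮n =
  ℕ.≤-trans (^length-filter≤product t ns≢0) (ℕ.m≤n*m (product ns) n ⦃ n≢0 ⦄)

^-cancelˡ-≤ : ∀ b {m n} → 1 ℕ.< b → b ℕ.^ m ℕ.≤ b ℕ.^ n → m ℕ.≤ n
^-cancelˡ-≤ b {m} {n} 1<b bᵐ≤bⁿ with m ℕ.≤? n
... | yes m≤n = m≤n
... | no  m≰n = contradiction (ℕ.^-monoʳ-< b 1<b (ℕ.≰⇒> m≰n)) (ℕ.≤⇒≯ bᵐ≤bⁿ)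

largePrimeFactors : ℕ → (n : ℕ) → .⦃ NonZero n ⦄ → List ℕ
largePrimeFactors t n = filter (t ℕ.<?_) (factors (factorise n))

-- If c factors exceed t, then (t + 1)^c ≤ n ≤ (t + 1)^k. The hypothesis 1 ≤ t makes the base exceed
-- 1, so exponents can be compared.
length-largePrimeFactors : ∀ t n k → .⦃ _ : NonZero n ⦄ → 1 ℕ.≤ t → n ℕ.≤ suc t ℕ.^ k →
  length (largePrimeFactors t n) ℕ.≤ k
length-largePrimeFactors t n k 1≤t n≤ = ^-cancelˡ-≤ (suc t) (s≤s 1≤t) (begin
  suc t ℕ.^ length (largePrimeFactors t n)  ≤⟨ ^length-filter≤product t (All.map prime⇒nonZero (factorsPrime f)) ⟩
  product (factors f)                       ≡⟨ isFactorisation f ⟨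
  n                                         ≤⟨ n≤ ⟩
  suc t ℕ.^ k                               ∎)
  where
  open ℕ.≤-Reasoning
  f = factorise n

∈-largePrimeFactors : ∀ {t n p} → .⦃ _ : NonZero n ⦄ → Prime p → p ∣ n → t ℕ.< p →
  p ∈ largePrimeFactors t n
∈-largePrimeFactors {t} {n} p-prime p∣n t<p = ∈-filter⁺ (t ℕ.<?_)
  (factorisationHasAllPrimeFactors p-prime
    (∣-trans p∣n (∣-reflexive (isFactorisation f))) (factorsPrime f))
  t<p
  where f = factorise n

length-concatMap-≤ : ∀ {A B : Set} {f : A → List B} {k xs} →
  All (λ x → length (f x) ℕ.≤ k) xs → length (concatMap f xs) ℕ.≤ length xs ℕ.* k
length-concatMap-≤ [] = z≤n
length-concatMap-≤ {f = f} {k} {x ∷ xs} (fx≤k ∷ fxs≤k) = begin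
  length (f x ++ concatMap f xs)            ≡⟨ length-++ (f x) ⟩
  length (f x) ℕ.+ length (concatMap f xs)  ≤⟨ ℕ.+-mono-≤ fx≤k (length-concatMap-≤ fxs≤k) ⟩
  k ℕ.+ length xs ℕ.* k                     ∎
  where open ℕ.≤-Reasoning

-- A list of length O(t) containing every prime to be counted.

module _ {ℓ} (ℓ-prime : Prime ℓ) (t : ℕ) where

  private
    largeFactorsAt : ℕ → List ℕ
    largeFactorsAt d = largePrimeFactors t ℤ.∣ eval (Φ ℓ) (+ d) ∣ ⦃ Φ-prime-nonZero ℓ-prime d ⦄

  -- Primes up to t are covered crudely by all of 0, ..., t, which costs only t + 1 entries.
  candidates : List ℕ
  candidates = upTo (suc t) ++ concatMap largeFactorsAt (upTo (suc t))

  ∈-candidates : ∀ {p d} → Prime p → p ∣Φ[ ℓ ] d → d ℕ.≤ t → p ∈ candidates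
  ∈-candidates {p} {d} p-prime p∣Φd d≤t with p ℕ.≤? t
  ... | yes p≤t = ∈-++⁺ˡ (∈-upTo⁺ (s≤s p≤t))
  ... | no  p≰t = ∈-++⁺ʳ (upTo (suc t)) (∈-concatMap⁺ largeFactorsAt (lose (∈-upTo⁺ (s≤s d≤t))
    (∈-largePrimeFactors ⦃ Φ-prime-nonZero ℓ-prime d ⦄ p-prime p∣Φd (ℕ.≰⇒> p≰t))))

  length-candidates : 1 ℕ.≤ t → length candidates ℕ.≤ suc ℓ ℕ.* suc t
  length-candidates 1≤t = begin
    length candidates
      ≡⟨ length-++ (upTo (suc t)) ⟩
    length (upTo (suc t)) ℕ.+ length (concatMap largeFactorsAt (upTo (suc t)))
      ≤⟨ ℕ.+-monoʳ-≤ (length (upTo (suc t))) (length-concatMap-≤ {f = largeFactorsAt} (All.map few (all-upTo (suc t)))) ⟩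
    length (upTo (suc t)) ℕ.+ length (upTo (suc t)) ℕ.* ℓ
      ≡⟨ cong (λ n → n ℕ.+ n ℕ.* ℓ) (length-upTo (suc t)) ⟩
    suc t ℕ.+ suc t ℕ.* ℓ
      ≡⟨ cong (suc t ℕ.+_) (ℕ.*-comm (suc t) ℓ) ⟩
    suc ℓ ℕ.* suc t ∎
    where
    open ℕ.≤-Reasoning
    few : ∀ {d} → d ℕ.< suc t → length (largeFactorsAt d) ℕ.≤ ℓ
    -- Since d ≤ t, the value is at most (1 + d)^ℓ ≤ (1 + t)^ℓ, so the exponent bounding the count
    -- is ℓ.
    few {d} d<1+t = length-largePrimeFactors t _ ℓ ⦃ Φ-prime-nonZero ℓ-prime d ⦄ 1≤t
      (ℕ.≤-trans (Φ-prime-≤ ℓ-prime d) (ℕ.^-monoˡ-≤ ℓ d<1+t))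

-- The position of p is computed from a decided membership, so that it does not
-- depend on the proof of A p.
injectsInto : ∀ {A : ℕ → Set} ps → (∀ {p} → A p → p ∈ ps) →
  Injection (On.setoid (setoid ℕ) (proj₁ {B = A})) (setoid (Fin (length ps)))
injectsInto {A} ps A⇒∈ = record
  { to        = λ (p , Ap) → position p (A⇒∈ Ap)
  ; cong      = λ { {p , _} refl → refl }
  ; injective = λ {x} {y} → index-injective (setoid ℕ)
      (recompute (_∈?_ ℕ._≟_ (proj₁ x) ps) (A⇒∈ (proj₂ x)))
      (recompute (_∈?_ ℕ._≟_ (proj₁ y) ps) (A⇒∈ (proj₂ y)))
  }
  where
  position : ∀ p → .(p ∈ ps) → Fin (length ps)
  position p p∈ps = index (recompute (_∈?_ ℕ._≟_ p ps) p∈ps)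

-- Natural numbers inside the rationals, and ceilings.

ι : ℕ → ℚ
ι n = + n ℚ./ 1

-- `_/_` normalises by a gcd that is stuck on a variable n; the explicit form exposes numerator and
-- denominator.
ι≡mkℚ : ∀ n → ι n ≡ mkℚ (+ n) 0 (Coprimality.sym (1-coprimeTo n))
ι≡mkℚ n = ℚ.↥p/↧p≡p (mkℚ (+ n) 0 (Coprimality.sym (1-coprimeTo n)))

ι-mono-≤ : ∀ {m n} → m ℕ.≤ n → ι m ℚ.≤ ι n
ι-mono-≤ {m} {n} m≤n rewrite ι≡mkℚ m | ι≡mkℚ n =
  ℚ.*≤* (ℤ.*-monoʳ-≤-nonNeg 1ℤ (ℤ.+≤+ m≤n))

ι-cancel-≤ : ∀ {m n} → ι m ℚ.≤ ι n → m ℕ.≤ n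
ι-cancel-≤ {m} {n} ιm≤ιn rewrite ι≡mkℚ m | ι≡mkℚ n =
  ℤ.drop‿+≤+ (ℤ.*-cancelʳ-≤-pos (+ m) (+ n) 1ℤ (ℚ.drop-*≤* ιm≤ιn))

ι-+ : ∀ m n → ι (m ℕ.+ n) ≡ ι m ℚ.+ ι n
ι-+ m n rewrite ι≡mkℚ m | ι≡mkℚ n =
  cong (ℚ._/ 1) (sym (cong₂ ℤ._+_ (ℤ.*-identityʳ (+ m)) (ℤ.*-identityʳ (+ n))))

ι-* : ∀ m n → ι (m ℕ.* n) ≡ ι m ℚ.* ι n
ι-* m n rewrite ι≡mkℚ m | ι≡mkℚ n = cong (ℚ._/ 1) (ℤ.pos-* m n)

-- The absolute value of the numerator suffices, as the denominator is at least 1.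
archimedean : ∀ q → ∃[ n ] q ℚ.≤ ι n
archimedean q@(mkℚ n d-1 _) = ℤ.∣ n ∣ ,
  subst (q ℚ.≤_) (sym (ι≡mkℚ ℤ.∣ n ∣)) (ℚ.*≤* (begin
    n ℤ.* 1ℤ                ≡⟨ ℤ.*-identityʳ n ⟩
    n                       ≤⟨ n≤∣n∣ n ⟩
    + ℤ.∣ n ∣               ≤⟨ ℤ.+≤+ (ℕ.m≤m*n ℤ.∣ n ∣ (suc d-1)) ⟩
    + (ℤ.∣ n ∣ ℕ.* suc d-1) ≡⟨ ℤ.pos-* ℤ.∣ n ∣ (suc d-1) ⟩
    + ℤ.∣ n ∣ ℤ.* + suc d-1 ∎))
  where
  open ℤ.≤-Reasoning
  n≤∣n∣ : ∀ i → i ℤ.≤ + ℤ.∣ i ∣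
  n≤∣n∣ (+ _)        = ℤ.≤-refl
  n≤∣n∣ ℤ.-[1+ _ ]   = ℤ.-≤+

-- Descend from an Archimedean bound until the next smaller integer lies below q. The hypothesis
-- serves the case where the descent reaches 0.
ceiling : ∀ q → 0ℚ ℚ.≤ q ℚ.+ 1ℚ → ∃[ k ] q ℚ.≤ ι k × ι k ℚ.≤ q ℚ.+ 1ℚ
ceiling q 0≤q+1 = let n , q≤n = archimedean q in descend n q≤n
  where
  descend : ∀ n → q ℚ.≤ ι n → ∃[ k ] q ℚ.≤ ι k × ι k ℚ.≤ q ℚ.+ 1ℚ
  descend zero    q≤0   = zero , q≤0 , 0≤q+1
  descend (suc n) q≤1+n with q ℚ.≤? ι n
  ... | yes q≤n = descend n q≤n
  ... | no  q≰n = suc n , q≤1+n , (begin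
    ι (suc n)       ≡⟨ cong ι (ℕ.+-comm 1 n) ⟩
    ι (n ℕ.+ 1)     ≡⟨ ι-+ n 1 ⟩
    ι n ℚ.+ 1ℚ      ≤⟨ ℚ.+-monoˡ-≤ 1ℚ (ℚ.<⇒≤ (ℚ.≰⇒> q≰n)) ⟩
    q ℚ.+ 1ℚ        ∎)
    where open ℚ.≤-Reasoning

p≤∣p∣ : ∀ p → p ℚ.≤ ∣ p ∣
p≤∣p∣ p with ℚ.≤-total 0ℚ p
... | inj₁ 0≤p = ℚ.≤-reflexive (sym (ℚ.0≤p⇒∣p∣≡p 0≤p))
... | inj₂ p≤0 = ℚ.≤-trans p≤0 (ℚ.0≤∣p∣ p)

-- Turns the Cauchy condition into one-sided bounds between terms.
∣p-q∣<r⇒p≤q+r : ∀ p q {r} → ∣ p ℚ.- q ∣ ℚ.< r → p ℚ.≤ q ℚ.+ r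
∣p-q∣<r⇒p≤q+r p q {r} ∣p-q∣<r = begin
  p                     ≡⟨ solve 2 (λ p q → p := q :+ (p :- q)) refl p q ⟩
  q ℚ.+ (p ℚ.- q)       ≤⟨ ℚ.+-monoʳ-≤ q (p≤∣p∣ (p ℚ.- q)) ⟩
  q ℚ.+ ∣ p ℚ.- q ∣     ≤⟨ ℚ.+-monoʳ-≤ q (ℚ.<⇒≤ ∣p-q∣<r) ⟩
  q ℚ.+ r               ∎
  where
  open ℚ.≤-Reasoning
  open +-*-Solver

+-cancelʳ-≤ : ∀ r {p q} → p ℚ.+ r ℚ.≤ q ℚ.+ r → p ℚ.≤ q
+-cancelʳ-≤ r {p} {q} p+r≤q+r = begin
  p                  ≡⟨ solve 2 (λ p r → p := p :+ r :- r) refl p r ⟩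
  p ℚ.+ r ℚ.- r      ≤⟨ ℚ.+-monoˡ-≤ (ℚ.- r) p+r≤q+r ⟩
  q ℚ.+ r ℚ.- r      ≡⟨ solve 2 (λ q r → q :+ r :- r := q) refl q r ⟩
  q                  ∎
  where
  open ℚ.≤-Reasoning
  open +-*-Solver

-- Passing from a real bound to an integer bound.

-- The witness is t = ⌈ q ⌉ + 2, where q approximates T up to 1; the hypothesis
-- 2 ≤ T makes t + 1 ≤ T + 5 linear in T.
integerBound : ∀ T → fromℕ 2 ≤ T → ∃[ t ]
  1 ℕ.≤ t × (∀ d → fromℕ d ≤ T → d ℕ.≤ t) ×
  ∃[ N ] ∀ n → N ℕ.≤ n → ι (suc t) ℚ.≤ ι 6 ℚ.* seq T n
integerBound T 2≤T =
  2 ℕ.+ k , s≤s z≤n , below , K ℕ.⊔ L , linear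
  where
  0<1 : 0ℚ ℚ.< 1ℚ
  0<1 = ℚ.positive⁻¹ 1ℚ

  K L : ℕ
  K = proj₁ (cauchy T 1ℚ 0<1)
  L = proj₁ (2≤T 1ℚ 0<1)

  q : ℚ
  q = seq T K

  seq≤q+1 : ∀ n → K ℕ.≤ n → seq T n ℚ.≤ q ℚ.+ 1ℚ
  seq≤q+1 n K≤n = ∣p-q∣<r⇒p≤q+r (seq T n) q (proj₂ (cauchy T 1ℚ 0<1) n K K≤n ℕ.≤-refl)

  q≤seq+1 : ∀ n → K ℕ.≤ n → q ℚ.≤ seq T n ℚ.+ 1ℚ
  q≤seq+1 n K≤n = ∣p-q∣<r⇒p≤q+r q (seq T n) (proj₂ (cauchy T 1ℚ 0<1) K n ℕ.≤-refl K≤n)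

  1≤seq : ∀ n → L ℕ.≤ n → 1ℚ ℚ.≤ seq T n
  -- Taking ε = 1 in 2 ≤ T gives only 2 ≤ `seq T n` + 1; the threshold 2 leaves a lower bound of 1.
  1≤seq n L≤n = +-cancelʳ-≤ 1ℚ (proj₂ (2≤T 1ℚ 0<1) n L≤n)

  open ℚ.≤-Reasoning

  0≤q+1 : 0ℚ ℚ.≤ q ℚ.+ 1ℚ
  0≤q+1 = begin
    0ℚ                ≤⟨ ℚ.<⇒≤ 0<1 ⟩
    1ℚ                ≤⟨ 1≤seq (K ℕ.⊔ L) (ℕ.m≤n⊔m K L) ⟩
    seq T (K ℕ.⊔ L)   ≤⟨ seq≤q+1 (K ℕ.⊔ L) (ℕ.m≤m⊔n K L) ⟩
    q ℚ.+ 1ℚ          ∎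

  k : ℕ
  k = proj₁ (ceiling q 0≤q+1)

  below : ∀ d → fromℕ d ≤ T → d ℕ.≤ 2 ℕ.+ k
  -- One unit is lost to ε = 1 in d ≤ T and one to the Cauchy approximation, whence the 2 added to
  -- k.
  below d d≤T = let M , d≤seq+1 = d≤T 1ℚ 0<1 in ι-cancel-≤ (begin
    ι d                     ≤⟨ d≤seq+1 (K ℕ.⊔ M) (ℕ.m≤n⊔m K M) ⟩
    seq T (K ℕ.⊔ M) ℚ.+ 1ℚ  ≤⟨ ℚ.+-monoˡ-≤ 1ℚ (seq≤q+1 (K ℕ.⊔ M) (ℕ.m≤m⊔n K M)) ⟩
    q ℚ.+ 1ℚ ℚ.+ 1ℚ         ≡⟨ ℚ.+-assoc q 1ℚ 1ℚ ⟩
    q ℚ.+ ι 2               ≤⟨ ℚ.+-monoˡ-≤ (ι 2) (proj₁ (proj₂ (ceiling q 0≤q+1))) ⟩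
    ι k ℚ.+ ι 2             ≡⟨ ι-+ k 2 ⟨
    ι (k ℕ.+ 2)             ≡⟨ cong ι (ℕ.+-comm k 2) ⟩
    ι (2 ℕ.+ k)             ∎)

  linear : ∀ n → K ℕ.⊔ L ℕ.≤ n → ι (3 ℕ.+ k) ℚ.≤ ι 6 ℚ.* seq T n
  linear n N≤n = begin
    ι (3 ℕ.+ k)                 ≡⟨ cong ι (ℕ.+-comm 3 k) ⟩
    ι (k ℕ.+ 3)                 ≡⟨ ι-+ k 3 ⟩
    ι k ℚ.+ ι 3                 ≤⟨ ℚ.+-monoˡ-≤ (ι 3) (proj₂ (proj₂ (ceiling q 0≤q+1))) ⟩
    q ℚ.+ 1ℚ ℚ.+ ι 3            ≤⟨ ℚ.+-monoˡ-≤ (ι 3) (ℚ.+-monoˡ-≤ 1ℚ (q≤seq+1 n (ℕ.m⊔n≤o⇒m≤o K L N≤n))) ⟩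
    x ℚ.+ 1ℚ ℚ.+ 1ℚ ℚ.+ ι 3     ≡⟨ solve 1 (λ x → x :+ con 1ℚ :+ con 1ℚ :+ con (ι 3) := x :+ con (ι 5) :* con 1ℚ) refl x ⟩
    -- As 1 ≤ x, the constant 5 is absorbed into 5 x, which gives the factor 6.
    x ℚ.+ ι 5 ℚ.* 1ℚ            ≤⟨ ℚ.+-monoʳ-≤ x (ℚ.*-monoˡ-≤-nonNeg (ι 5) (1≤seq n (ℕ.m⊔n≤o⇒n≤o K L N≤n))) ⟩
    x ℚ.+ ι 5 ℚ.* x             ≡⟨ solve 1 (λ x → x :+ con (ι 5) :* x := con (ι 6) :* x) refl x ⟩
    ι 6 ℚ.* x                   ∎
    where
    open +-*-Solver
    x = seq T n

theorem1 : (ℓ : ℕ) → Prime ℓ → 2 ∤ ℓ →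
    ∃[ C ] ∃[ T₀ ] ((T : ℝ) → T₀ ≤ T → ∣ S 1 ℓ T ∣≤ (C * T))
-- C = 6 (ℓ + 1): the list has at most (ℓ + 1)(t + 1) entries, and t + 1 is eventually at most 6
-- times the terms of T once T ≥ 2.
theorem1 ℓ ℓ-prime _ = fromℚ (ι (suc ℓ) ℚ.* ι 6) , fromℕ 2 , λ T 2≤T →
  let t , 1≤t , below , N , linear = integerBound T 2≤T
      ps = candidates ℓ-prime t
  -- The inequality holds without slack from N on, so the same N serves every ε.
  in length ps , injectsInto {S 1 ℓ T} ps (S⇒∈ T t below) , λ ε 0<ε → N , λ n N≤n → begin
    ι (length ps)
      ≤⟨ ι-mono-≤ (length-candidates ℓ-prime t 1≤t) ⟩
    ι (suc ℓ ℕ.* suc t)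
      ≡⟨ ι-* (suc ℓ) (suc t) ⟩
    ι (suc ℓ) ℚ.* ι (suc t)
      ≤⟨ ℚ.*-monoˡ-≤-nonNeg (ι (suc ℓ)) ⦃ ℚ.normalize-nonNeg (suc ℓ) 1 ⦄ (linear n N≤n) ⟩
    ι (suc ℓ) ℚ.* (ι 6 ℚ.* seq T n)
      ≡⟨ ℚ.*-assoc (ι (suc ℓ)) (ι 6) (seq T n) ⟨
    ι (suc ℓ) ℚ.* ι 6 ℚ.* seq T n
      ≡⟨ ℚ.+-identityʳ (ι (suc ℓ) ℚ.* ι 6 ℚ.* seq T n) ⟨
    ι (suc ℓ) ℚ.* ι 6 ℚ.* seq T n ℚ.+ 0ℚ
      ≤⟨ ℚ.+-monoʳ-≤ (ι (suc ℓ) ℚ.* ι 6 ℚ.* seq T n) (ℚ.<⇒≤ 0<ε) ⟩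
    ι (suc ℓ) ℚ.* ι 6 ℚ.* seq T n ℚ.+ ε ∎
  where
  open ℚ.≤-Reasoning
  S⇒∈ : ∀ T t → (∀ d → fromℕ d ≤ T → d ℕ.≤ t) → ∀ {p} → S 1 ℓ T p → p ∈ candidates ℓ-prime t
  -- The value ∞ is excluded because `⊤⁺ ≤⁺ T` is empty, and `p ℕ.^ 1` unfolds to `p ℕ.* 1`.
  S⇒∈ T t below {p} ((p-prime , _) , [ d ] , (p¹∣Φd , _) , d≤T) =
    ∈-candidates ℓ-prime t p-prime
      (subst (λ n → n ∣Φ[ ℓ ] d) (ℕ.*-identityʳ p) p¹∣Φd) (below d d≤T)
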